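{- Let $\mathcal{G}=(\mathcal{V},\mathcal{E})$ be a directed graph with terminals $s,t$ and $f:2^{\mathcal{E}}\to\mathbb{R}_+$ normalized, monotone nondecreasing and submodular. Let $\widehat C$ be an $(s,t)$-cut minimizing $\hat f_{\mathrm{pf}}$, and let $C^*$ be a minimal $(s,t)$-cut minimizing $f$. Let $\Delta_s=\{v: \exists (v,u)\in C^*\}$ and $\Delta_t=\{v:\exists (u,v)\in C^*\}$. Then $$f(\widehat C)\le \min\{|\Delta_s|,|\Delta_t|\}\,f(C^*)\le \frac{|\mathcal{V}|}{2}f(C^*).$$
   Context: An $(s,t)$-cut is a set of edges whose removal disconnects all $s$-$t$ paths; it is minimal if no proper subset is an $(s,t)$-cut. For $C\subseteq\mathcal{E}$, let $\mathcal{P}_C$ be the family of all partitions $\{C^\Pi_v\}_{v\in\mathcal{V}}$ of $C$ obtained by assigning each edge $(u,w)\in C$ either to its tail $u$ or to its head $w$ ($C^\Pi_v$ = edges assigned to $v$, possibly empty), and $\hat f_{\mathrm{pf}}(C)=\min_{\Pi(C)\in\mathcal{P}_C}\sum_{v\in\mathcal{V}}f(C^\Pi_v)$. -}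

module Defs where

open import Data.Bool.Base using (_∧_; if_then_else_)
open import Data.Fin.Base using (Fin)
open import Data.Fin.Properties using (any?) renaming (_≟_ to _≟ᶠ_)
open import Data.Fin.Subset using (Subset; inside; outside; _∈_; _∉_; _⊆_; _⊂_; _∪_; _∩_; ⊥)
open import Data.Fin.Subset.Properties using (_∈?_)
open import Data.Integer.Base using (+_)
open import Data.Nat.Base as ℕ using (ℕ; zero; suc)
import Data.Nat.Properties as ℕ
open import Data.Product.Base using (∃; _×_; _,_)
open import Data.Rational.Base as ℚ using (ℚ; 0ℚ; 1ℚ; ½; ∣_∣; positive)
import Data.Rational.Properties as ℚ
open import Data.Rational.Solver using (module +-*-Solver)
open import Data.Sum.Base using (inj₁; inj₂)
open import Data.Vec.Base as Vec using ([]; _∷_; lookup; tabulate)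
open import Data.Vec.Functional using (foldr)
open import Relation.Binary.Construct.Closure.ReflexiveTransitive using (Star)
open import Relation.Binary.PropositionalEquality
  using (_≡_; refl; sym; trans; cong; subst; subst₂)
open import Relation.Nullary using (¬_; does; _×-dec_)

-- Real numbers as Cauchy sequences of rationals, with the defined
-- equality _≃ᴿ_ in place of a quotient.

IsCauchy : (ℕ → ℚ) → Set
IsCauchy x = ∀ ε → 0ℚ ℚ.< ε →
  ∃ λ N → ∀ i j → N ℕ.≤ i → N ℕ.≤ j → ∣ x i ℚ.- x j ∣ ℚ.< ε

record ℝ : Set where
  constructor mkℝ
  field
    seq    : ℕ → ℚ
    cauchy : IsCauchy seq

open ℝ public

infix  4 _≤ᴿ_ _≃ᴿ_
infixl 6 _+ᴿ_
infixl 7 _*ᴿ_ _⊓ᴿ_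

_≤ᴿ_ : ℝ → ℝ → Set
x ≤ᴿ y = ∀ ε → 0ℚ ℚ.< ε → ∃ λ N → ∀ i → N ℕ.≤ i → seq x i ℚ.≤ seq y i ℚ.+ ε

_≃ᴿ_ : ℝ → ℝ → Set
x ≃ᴿ y = x ≤ᴿ y × y ≤ᴿ x

private
  open +-*-Solver

  half-pos : ∀ {ε} → 0ℚ ℚ.< ε → 0ℚ ℚ.< ε ℚ.* ½
  half-pos {ε} 0<ε =
    ℚ.positive⁻¹ (ε ℚ.* ½) {{ℚ.pos*pos⇒pos ε {{positive 0<ε}} ½}}

  half+half : ∀ ε → ε ℚ.* ½ ℚ.+ ε ℚ.* ½ ≡ ε
  half+half ε = trans (sym (ℚ.*-distribˡ-+ ε ½ ½)) (ℚ.*-identityʳ ε)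

  ∣-∣-comm : ∀ p q → ∣ p ℚ.- q ∣ ≡ ∣ q ℚ.- p ∣
  ∣-∣-comm p q = trans (cong ∣_∣ (lem p q)) (ℚ.∣-p∣≡∣p∣ (q ℚ.- p))
    where
    lem : ∀ p q → p ℚ.- q ≡ ℚ.- (q ℚ.- p)
    lem = solve 2 (λ p q → p :- q := :- (q :- p)) refl

  p≤∣p∣ : ∀ p → p ℚ.≤ ∣ p ∣
  p≤∣p∣ p with ℚ.≤-total 0ℚ p
  ... | inj₁ 0≤p = ℚ.≤-reflexive (sym (ℚ.0≤p⇒∣p∣≡p 0≤p))
  ... | inj₂ p≤0 = ℚ.≤-trans p≤0 (ℚ.0≤∣p∣ p)

  q+[p-q] : ∀ p q → q ℚ.+ (p ℚ.- q) ≡ p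
  q+[p-q] = solve 2 (λ p q → q :+ (p :- q) := p) refl

  <-from-∣-∣ : ∀ {p q ε} → ∣ p ℚ.- q ∣ ℚ.< ε → p ℚ.< q ℚ.+ ε
  <-from-∣-∣ {p} {q} {ε} h = subst (ℚ._< q ℚ.+ ε) (q+[p-q] p q)
    (ℚ.+-monoʳ-< q (ℚ.≤-<-trans (p≤∣p∣ (p ℚ.- q)) h))

  diff-< : ∀ {p q ε} → p ℚ.< q ℚ.+ ε → p ℚ.- q ℚ.< ε
  diff-< {p} {q} {ε} h =
    subst (p ℚ.- q ℚ.<_) (lem q ε) (ℚ.+-monoˡ-< (ℚ.- q) h)
    where
    lem : ∀ q ε → q ℚ.+ ε ℚ.- q ≡ ε
    lem = solve 2 (λ q ε → q :+ ε :- q := ε) refl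

  ∣-∣-from-< : ∀ {p q ε} → p ℚ.< q ℚ.+ ε → q ℚ.< p ℚ.+ ε → ∣ p ℚ.- q ∣ ℚ.< ε
  ∣-∣-from-< {p} {q} {ε} h k with ℚ.∣p∣≡p∨∣p∣≡-p (p ℚ.- q)
  ... | inj₁ e = subst (ℚ._< ε) (sym e) (diff-< h)
  ... | inj₂ e = subst (ℚ._< ε) (sym (trans e (lem p q))) (diff-< k)
    where
    lem : ∀ p q → ℚ.- (p ℚ.- q) ≡ q ℚ.- p
    lem = solve 2 (λ p q → :- (p :- q) := q :- p) refl

  ⊓-< : ∀ {a b c d ε} → a ℚ.< c ℚ.+ ε → b ℚ.< d ℚ.+ ε → a ℚ.⊓ b ℚ.< c ℚ.⊓ d ℚ.+ ε
  ⊓-< {a} {b} {c} {d} {ε} h k with ℚ.⊓-sel c d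
  ... | inj₁ e = subst (λ z → a ℚ.⊓ b ℚ.< z ℚ.+ ε) (sym e)
                   (ℚ.≤-<-trans (ℚ.p⊓q≤p a b) h)
  ... | inj₂ e = subst (λ z → a ℚ.⊓ b ℚ.< z ℚ.+ ε) (sym e)
                   (ℚ.≤-<-trans (ℚ.p⊓q≤q a b) k)

  shrink : ∀ K → 0ℚ ℚ.≤ K → ∀ ε → 0ℚ ℚ.< ε →
           ∃ λ δ → 0ℚ ℚ.< δ × (∀ r → r ℚ.< δ → K ℚ.* r ℚ.≤ ε)
  shrink K 0≤K ε 0<ε = δ , ℚ.positive⁻¹ δ {{δ-pos}} , bound
    where
    L = K ℚ.+ 1ℚ
    instance
      K≥0 : ℚ.NonNegative K
      K≥0 = ℚ.nonNegative 0≤K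
      L>0 : ℚ.Positive L
      L>0 = ℚ.nonNeg+pos⇒pos K 1ℚ
      L≠0 : ℚ.NonZero L
      L≠0 = ℚ.pos⇒nonZero L
      L⁻¹>0 : ℚ.Positive (ℚ.1/ L)
      L⁻¹>0 = ℚ.1/pos⇒pos L
      ε>0 : ℚ.Positive ε
      ε>0 = positive 0<ε
    δ = (ℚ.1/ L) ℚ.* ε
    instance
      δ-pos : ℚ.Positive δ
      δ-pos = ℚ.pos*pos⇒pos (ℚ.1/ L) ε
    Lδ≡ε : L ℚ.* δ ≡ ε
    Lδ≡ε = trans (sym (ℚ.*-assoc L (ℚ.1/ L) ε))
             (trans (cong (ℚ._* ε) (ℚ.*-inverseʳ L)) (ℚ.*-identityˡ ε))
    K≤L : K ℚ.≤ L
    K≤L = subst (ℚ._≤ L) (ℚ.+-identityʳ K)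
            (ℚ.+-monoʳ-≤ K (ℚ.nonNegative⁻¹ 1ℚ))
    bound : ∀ r → r ℚ.< δ → K ℚ.* r ℚ.≤ ε
    bound r r<δ = ℚ.≤-trans (ℚ.*-monoˡ-≤-nonNeg K (ℚ.<⇒≤ r<δ))
      (ℚ.≤-trans (ℚ.*-monoʳ-≤-nonNeg δ {{ℚ.pos⇒nonNeg δ}} K≤L)
                 (ℚ.≤-reflexive Lδ≡ε))

  bounded : ∀ x → ∃ λ K → 0ℚ ℚ.≤ K ×
            ∃ λ N → ∀ i → N ℕ.≤ i → ∣ seq x i ∣ ℚ.≤ K
  bounded x with cauchy x 1ℚ (ℚ.positive⁻¹ 1ℚ)
  ... | N , h = ∣ seq x N ∣ ℚ.+ 1ℚ
              , ℚ.+-mono-≤ (ℚ.0≤∣p∣ (seq x N)) (ℚ.nonNegative⁻¹ 1ℚ)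
              , N , λ i N≤i → subst (λ z → ∣ z ∣ ℚ.≤ ∣ seq x N ∣ ℚ.+ 1ℚ)
                  (q+[p-q] (seq x i) (seq x N))
                  (ℚ.≤-trans (ℚ.∣p+q∣≤∣p∣+∣q∣ (seq x N) (seq x i ℚ.- seq x N))
                    (ℚ.+-monoʳ-≤ ∣ seq x N ∣ (ℚ.<⇒≤ (h i N N≤i ℕ.≤-refl))))

  half-< : ∀ {ε} → 0ℚ ℚ.< ε → ε ℚ.* ½ ℚ.< ε
  half-< {ε} 0<ε = subst₂ ℚ._<_ (ℚ.+-identityˡ (ε ℚ.* ½)) (half+half ε)
    (ℚ.+-monoˡ-< (ε ℚ.* ½) (half-pos 0<ε))

fromℚ : ℚ → ℝ
fromℚ q = mkℝ (λ _ → q) λ ε 0<ε →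
  0 , λ _ _ _ _ → subst (ℚ._< ε) (sym (cong ∣_∣ (ℚ.+-inverseʳ q))) 0<ε

fromℕ : ℕ → ℝ
fromℕ k = fromℚ (+ k ℚ./ 1)

0ᴿ : ℝ
0ᴿ = fromℚ 0ℚ

_+ᴿ_ : ℝ → ℝ → ℝ
x +ᴿ y = mkℝ (λ i → seq x i ℚ.+ seq y i) λ ε 0<ε →
  let M , h = cauchy x (ε ℚ.* ½) (half-pos 0<ε)
      N , k = cauchy y (ε ℚ.* ½) (half-pos 0<ε)
  in M ℕ.⊔ N , λ i j p q → subst₂ ℚ._<_
       (cong ∣_∣ (lem (seq x i) (seq x j) (seq y i) (seq y j))) (half+half ε)
       (ℚ.≤-<-trans
         (ℚ.∣p+q∣≤∣p∣+∣q∣ (seq x i ℚ.- seq x j) (seq y i ℚ.- seq y j))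
         (ℚ.+-mono-<
           (h i j (ℕ.m⊔n≤o⇒m≤o M N p) (ℕ.m⊔n≤o⇒m≤o M N q))
           (k i j (ℕ.m⊔n≤o⇒n≤o M N p) (ℕ.m⊔n≤o⇒n≤o M N q))))
  where
  lem : ∀ a b c d → (a ℚ.- b) ℚ.+ (c ℚ.- d) ≡ (a ℚ.+ c) ℚ.- (b ℚ.+ d)
  lem = solve 4 (λ a b c d → (a :- b) :+ (c :- d) := (a :+ c) :- (b :+ d)) refl

_⊓ᴿ_ : ℝ → ℝ → ℝ
x ⊓ᴿ y = mkℝ (λ i → seq x i ℚ.⊓ seq y i) λ ε 0<ε →
  let M , h = cauchy x ε 0<ε
      N , k = cauchy y ε 0<ε
      below : ∀ i j → M ℕ.⊔ N ℕ.≤ i → M ℕ.⊔ N ℕ.≤ j →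
              seq x i ℚ.⊓ seq y i ℚ.< seq x j ℚ.⊓ seq y j ℚ.+ ε
      below i j p q = ⊓-< {seq x i} {seq y i} {seq x j} {seq y j}
        (<-from-∣-∣ (h i j (ℕ.m⊔n≤o⇒m≤o M N p) (ℕ.m⊔n≤o⇒m≤o M N q)))
        (<-from-∣-∣ (k i j (ℕ.m⊔n≤o⇒n≤o M N p) (ℕ.m⊔n≤o⇒n≤o M N q)))
  in M ℕ.⊔ N , λ i j p q → ∣-∣-from-< (below i j p q) (below j i q p)

_*ᴿ_ : ℝ → ℝ → ℝ
x *ᴿ y = mkℝ (λ i → seq x i ℚ.* seq y i) cauchy-*
  where
  lem : ∀ a b c d → a ℚ.* (c ℚ.- d) ℚ.+ d ℚ.* (a ℚ.- b) ≡ a ℚ.* c ℚ.- b ℚ.* d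
  lem = solve 4 (λ a b c d →
    a :* (c :- d) :+ d :* (a :- b) := a :* c :- b :* d) refl

  scaled : ∀ {a K} → ∣ a ∣ ℚ.≤ K → ∀ r → ∣ a ℚ.* r ∣ ℚ.≤ K ℚ.* ∣ r ∣
  scaled {a} {K} h r = subst (ℚ._≤ K ℚ.* ∣ r ∣) (sym (ℚ.∣p*q∣≡∣p∣*∣q∣ a r))
    (ℚ.*-monoʳ-≤-nonNeg ∣ r ∣ {{ℚ.∣-∣-nonNeg r}} h)

  cauchy-* : IsCauchy (λ i → seq x i ℚ.* seq y i)
  cauchy-* ε 0<ε =
    let K , 0≤K , A , x≤K = bounded x
        L , 0≤L , B , y≤L = bounded y
        η = ε ℚ.* ½ ℚ.* ½
        0<η = half-pos (half-pos 0<ε)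
        δ , 0<δ , Kδ = shrink K 0≤K η 0<η
        γ , 0<γ , Lγ = shrink L 0≤L η 0<η
        M , h = cauchy y δ 0<δ
        N , k = cauchy x γ 0<γ
        P = (A ℕ.⊔ B) ℕ.⊔ (M ℕ.⊔ N)
        toA = λ {i} (p : P ℕ.≤ i) → ℕ.m⊔n≤o⇒m≤o A B (ℕ.m⊔n≤o⇒m≤o (A ℕ.⊔ B) (M ℕ.⊔ N) p)
        toB = λ {i} (p : P ℕ.≤ i) → ℕ.m⊔n≤o⇒n≤o A B (ℕ.m⊔n≤o⇒m≤o (A ℕ.⊔ B) (M ℕ.⊔ N) p)
        toM = λ {i} (p : P ℕ.≤ i) → ℕ.m⊔n≤o⇒m≤o M N (ℕ.m⊔n≤o⇒n≤o (A ℕ.⊔ B) (M ℕ.⊔ N) p)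
        toN = λ {i} (p : P ℕ.≤ i) → ℕ.m⊔n≤o⇒n≤o M N (ℕ.m⊔n≤o⇒n≤o (A ℕ.⊔ B) (M ℕ.⊔ N) p)
    in P , λ i j p q →
      let a = seq x i ; b = seq x j ; c = seq y i ; d = seq y j in
      subst (λ z → ∣ z ∣ ℚ.< ε) (lem a b c d)
        (ℚ.≤-<-trans
          (ℚ.≤-trans (ℚ.∣p+q∣≤∣p∣+∣q∣ (a ℚ.* (c ℚ.- d)) (d ℚ.* (a ℚ.- b)))
            (ℚ.+-mono-≤
              (ℚ.≤-trans (scaled (x≤K i (toA p)) (c ℚ.- d)) (Kδ _ (h i j (toM p) (toM q))))
              (ℚ.≤-trans (scaled (y≤L j (toB q)) (a ℚ.- b)) (Lγ _ (k i j (toN p) (toN q))))))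
          (subst (ℚ._< ε) (sym (half+half (ε ℚ.* ½))) (half-< 0<ε)))

sumᴿ : ∀ {n} → (Fin n → ℝ) → ℝ
sumᴿ g = foldr _+ᴿ_ 0ᴿ g

minᴿ : ∀ {m} → (Subset m → ℝ) → ℝ
minᴿ {zero}  g = g []
minᴿ {suc m} g = minᴿ (λ A → g (outside ∷ A)) ⊓ᴿ minᴿ (λ A → g (inside ∷ A))

module _ {m : ℕ} (f : Subset m → ℝ) where

  Nonnegative : Set
  Nonnegative = ∀ A → 0ᴿ ≤ᴿ f A

  Normalized : Set
  Normalized = f ⊥ ≃ᴿ 0ᴿ

  Monotone : Set
  Monotone = ∀ A B → A ⊆ B → f A ≤ᴿ f B

  Submodular : Set
  Submodular = ∀ A B → f (A ∪ B) +ᴿ f (A ∩ B) ≤ᴿ f A +ᴿ f B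

-- Edge e is the pair (tail e , head e); loops and parallel edges are allowed.
record Digraph (n m : ℕ) : Set where
  field
    tail : Fin m → Fin n
    head : Fin m → Fin n

module _ {n m : ℕ} (G : Digraph n m) where
  open Digraph G

  StepAvoiding : Subset m → Fin n → Fin n → Set
  StepAvoiding C u w = ∃ λ e → e ∉ C × tail e ≡ u × head e ≡ w

  IsCut : (s t : Fin n) → Subset m → Set
  IsCut s t C = ¬ Star (StepAvoiding C) s t

  IsMinimalCut : (s t : Fin n) → Subset m → Set
  IsMinimalCut s t C = IsCut s t C × (∀ D → D ⊂ C → ¬ IsCut s t D)

  -- An assignment is encoded by the set H of edges assigned to their head,
  -- all others being assigned to their tail.
  assignedEnd : Subset m → Fin m → Fin n
  assignedEnd H e = if lookup H e then head e else tail e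

  block : (C H : Subset m) → Fin n → Subset m
  block C H v = tabulate λ e → lookup C e ∧ does (assignedEnd H e ≟ᶠ v)

  -- H ranges over all edge sets: its elements outside C do not affect the
  -- blocks, so this is the minimum over all partitions in 𝒫_C.
  f̂pf : (Subset m → ℝ) → Subset m → ℝ
  f̂pf f C = minᴿ λ H → sumᴿ λ v → f (block C H v)

  Δs : Subset m → Subset n
  Δs C = tabulate λ v → does (any? λ e → e ∈? C ×-dec tail e ≟ᶠ v)

  Δt : Subset m → Subset n
  Δt C = tabulate λ v → does (any? λ e → e ∈? C ×-dec head e ≟ᶠ v)

  MinimizesPF : (s t : Fin n) → (Subset m → ℝ) → Subset m → Set
  MinimizesPF s t f C =
    IsCut s t C × (∀ D → IsCut s t D → f̂pf f C ≤ᴿ f̂pf f D)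

  MinimalMinimizer : (s t : Fin n) → (Subset m → ℝ) → Subset m → Set
  MinimalMinimizer s t f C =
    IsMinimalCut s t C × (∀ D → IsMinimalCut s t D → f C ≤ᴿ f D)

{-# OPTIONS --safe #-}
module Submission where

-- Subadditivity gives f Ĉ ≤ f̂pf Ĉ, and f̂pf Ĉ ≤ f̂pf C* by the choice of Ĉ.
-- Assigning every edge of C* to its tail leaves at most |Δs| nonempty blocks,
-- each of value at most f C*; likewise for heads and Δt.  If C* is minimal, every
-- tail of C* is reachable from s, and t from every head, along edges outside C*.
-- A vertex in both Δs and Δt would thus give an s-t path avoiding C*, so Δs and Δt
-- are disjoint and the smaller of them has at most n/2 elements.

open import Defs
open import Data.Fin.Base using (Fin)
open import Data.Fin.Subset using (Subset; ∣_∣)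
open import Data.Integer.Base using (+_)
open import Data.Nat.Base using (ℕ; _⊓_)
open import Data.Product.Base using (_×_)
open import Data.Rational.Base using (_/_)

open import Data.Bool.Base using (Bool; true; _∧_)
open import Data.Bool.Properties using (∧-conicalˡ; ∧-conicalʳ)
open import Data.Empty using () renaming (⊥-elim to absurd)
open import Data.Fin.Base using (zero; suc)
open import Data.Fin.Properties using (any?) renaming (_≟_ to _≟ᶠ_)
open import Data.Fin.Subset
  using (inside; outside; _∈_; _∉_; _⊆_; _∪_; _∩_; _-_; ⊥; ⊤)
open import Data.Fin.Subset.Properties
  using ( _∈?_; p⊆p∪q; q⊆p∪q; drop-there
        ; x∈p∧x≢y⇒x∈p-y; x∈p⇒p-x⊂p)
import Data.Integer.Base as ℤ
import Data.Integer.Properties as ℤ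
import Data.Nat.Base as ℕ
import Data.Nat.Properties as ℕ
open import Data.Product.Base using (∃; _,_; proj₁)
open import Data.Rational.Base as ℚ using (ℚ; 0ℚ; 1ℚ; ½)
import Data.Rational.Properties as ℚ
open import Data.Rational.Solver using (module +-*-Solver)
import Data.Rational.Unnormalised.Base as ℚᵘ
import Data.Rational.Unnormalised.Properties as ℚᵘ
open import Data.Sum.Base using (_⊎_; inj₁; inj₂; [_,_]′)
open import Data.Vec.Base using ([]; _∷_; here; there; lookup; tabulate)
open import Data.Vec.Functional using (foldr)
open import Data.Vec.Properties
  using (lookup∘tabulate; lookup-replicate; []=⇒lookup; lookup⇒[]=)
open import Function.Base using (_∘_)
open import Relation.Binary.Construct.Closure.ReflexiveTransitive
  using (Star; ε; _◅_; _◅◅_)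
open import Relation.Binary.Definitions using (Reflexive; Transitive; tri<; tri≈; tri>)
open import Relation.Binary.PropositionalEquality
  using (_≡_; refl; sym; trans; cong; cong₂; subst)
import Relation.Binary.Reasoning.Base.Single as Reasoning
open import Relation.Nullary using (¬_; Dec; yes; no; does; _×-dec_)
open import Relation.Nullary.Decidable using (dec-true)

-- Order, addition, minimum and scaling of Cauchy reals.

pointwise⇒≤ᴿ : ∀ x y → (∀ i → seq x i ℚ.≤ seq y i) → x ≤ᴿ y
pointwise⇒≤ᴿ x y h η 0<η = 0 , λ i _ →
  subst (ℚ._≤ seq y i ℚ.+ η) (ℚ.+-identityʳ (seq x i))
    (ℚ.+-mono-≤ (h i) (ℚ.<⇒≤ 0<η))

≤ᴿ-refl : Reflexive _≤ᴿ_
≤ᴿ-refl {x} = pointwise⇒≤ᴿ x x λ _ → ℚ.≤-refl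

half-positive : ∀ {η} → 0ℚ ℚ.< η → 0ℚ ℚ.< η ℚ.* ½
half-positive {η} 0<η =
  ℚ.positive⁻¹ (η ℚ.* ½) {{ℚ.pos*pos⇒pos η {{ℚ.positive 0<η}} ½}}

half+half≡ : ∀ η → η ℚ.* ½ ℚ.+ η ℚ.* ½ ≡ η
half+half≡ η = trans (sym (ℚ.*-distribˡ-+ η ½ ½)) (ℚ.*-identityʳ η)

≤ᴿ-trans : Transitive _≤ᴿ_
≤ᴿ-trans {x} {y} {z} x≤y y≤z η 0<η =
  let M , h = x≤y (η ℚ.* ½) (half-positive 0<η)
      N , k = y≤z (η ℚ.* ½) (half-positive 0<η)
  in M ℕ.⊔ N , λ i p → begin
    seq x i                               ≤⟨ h i (ℕ.m⊔n≤o⇒m≤o M N p) ⟩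
    seq y i ℚ.+ η ℚ.* ½                   ≤⟨ ℚ.+-monoˡ-≤ (η ℚ.* ½) (k i (ℕ.m⊔n≤o⇒n≤o M N p)) ⟩
    (seq z i ℚ.+ η ℚ.* ½) ℚ.+ η ℚ.* ½     ≡⟨ ℚ.+-assoc (seq z i) (η ℚ.* ½) (η ℚ.* ½) ⟩
    seq z i ℚ.+ (η ℚ.* ½ ℚ.+ η ℚ.* ½)     ≡⟨ cong (seq z i ℚ.+_) (half+half≡ η) ⟩
    seq z i ℚ.+ η                         ∎
  where open ℚ.≤-Reasoning

+ᴿ-mono-≤ᴿ : ∀ x y u v → x ≤ᴿ y → u ≤ᴿ v → x +ᴿ u ≤ᴿ y +ᴿ v
+ᴿ-mono-≤ᴿ x y u v x≤y u≤v η 0<η =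
  let M , h = x≤y (η ℚ.* ½) (half-positive 0<η)
      N , k = u≤v (η ℚ.* ½) (half-positive 0<η)
  in M ℕ.⊔ N , λ i p → subst (seq x i ℚ.+ seq u i ℚ.≤_)
       (trans (interchange (seq y i) (η ℚ.* ½) (seq v i) (η ℚ.* ½))
              (cong (seq y i ℚ.+ seq v i ℚ.+_) (half+half≡ η)))
       (ℚ.+-mono-≤ (h i (ℕ.m⊔n≤o⇒m≤o M N p)) (k i (ℕ.m⊔n≤o⇒n≤o M N p)))
  where
  open +-*-Solver
  interchange : ∀ a b c d → (a ℚ.+ b) ℚ.+ (c ℚ.+ d) ≡ (a ℚ.+ c) ℚ.+ (b ℚ.+ d)
  interchange = solve 4 (λ a b c d → (a :+ b) :+ (c :+ d) := (a :+ c) :+ (b :+ d)) refl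

x⊓ᴿy≤ᴿx : ∀ x y → x ⊓ᴿ y ≤ᴿ x
x⊓ᴿy≤ᴿx x y = pointwise⇒≤ᴿ (x ⊓ᴿ y) x λ i → ℚ.p⊓q≤p (seq x i) (seq y i)

x⊓ᴿy≤ᴿy : ∀ x y → x ⊓ᴿ y ≤ᴿ y
x⊓ᴿy≤ᴿy x y = pointwise⇒≤ᴿ (x ⊓ᴿ y) y λ i → ℚ.p⊓q≤q (seq x i) (seq y i)

-- At each index the minimum is one of the two terms. Which one may vary with the index, so both
-- bounds must already hold there, with the full tolerance `η`.
⊓ᴿ-glb : ∀ x y z → z ≤ᴿ x → z ≤ᴿ y → z ≤ᴿ x ⊓ᴿ y
⊓ᴿ-glb x y z z≤x z≤y η 0<η =
  let M , h = z≤x η 0<η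
      N , k = z≤y η 0<η
  in M ℕ.⊔ N , λ i p →
       [ (λ e → subst (λ w → seq z i ℚ.≤ w ℚ.+ η) (sym e) (h i (ℕ.m⊔n≤o⇒m≤o M N p)))
       , (λ e → subst (λ w → seq z i ℚ.≤ w ℚ.+ η) (sym e) (k i (ℕ.m⊔n≤o⇒n≤o M N p)))
       ]′ (ℚ.⊓-sel (seq x i) (seq y i))

-- The terms of a nonnegative real may be negative, so there is no termwise comparison. Eventually
-- `0 ≤ xᵢ + δ`, and multiplying by `d = q - p` costs an error of `d δ`. Choosing `δ = η / d` makes
-- this `η`; the case `p = q` is separate because it rules out the division.
*ᴿ-monoˡ-≤ : ∀ p q x → p ℚ.≤ q → 0ᴿ ≤ᴿ x → fromℚ p *ᴿ x ≤ᴿ fromℚ q *ᴿ x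
*ᴿ-monoˡ-≤ p q x p≤q 0≤x η 0<η with ℚ.<-cmp p q
... | tri≈ _ refl _ = ≤ᴿ-refl {fromℚ p *ᴿ x} η 0<η
... | tri> _ _ q<p  = absurd (ℚ.<-irrefl refl (ℚ.<-≤-trans q<p p≤q))
... | tri< p<q _ _  =
  let N , h = 0≤x δ (ℚ.positive⁻¹ δ) in N , λ i N≤i → begin
    p ℚ.* seq x i                                ≡⟨ ℚ.+-identityʳ _ ⟨
    p ℚ.* seq x i ℚ.+ 0ℚ                         ≡⟨ cong (p ℚ.* seq x i ℚ.+_) (ℚ.*-zeroʳ d) ⟨
    p ℚ.* seq x i ℚ.+ d ℚ.* 0ℚ                   ≤⟨ ℚ.+-monoʳ-≤ (p ℚ.* seq x i) (ℚ.*-monoˡ-≤-nonNeg d (h i N≤i)) ⟩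
    p ℚ.* seq x i ℚ.+ d ℚ.* (seq x i ℚ.+ δ)      ≡⟨ regroup p q (seq x i) δ ⟩
    q ℚ.* seq x i ℚ.+ d ℚ.* δ                    ≡⟨ cong (q ℚ.* seq x i ℚ.+_) dδ≡η ⟩
    q ℚ.* seq x i ℚ.+ η                          ∎
  where
  open ℚ.≤-Reasoning
  d = q ℚ.- p
  instance
    d>0 : ℚ.Positive d
    d>0 = ℚ.positive (subst (ℚ._< d) (ℚ.+-inverseʳ p) (ℚ.+-monoˡ-< (ℚ.- p) p<q))
    d≥0 : ℚ.NonNegative d
    d≥0 = ℚ.pos⇒nonNeg d
    d≠0 : ℚ.NonZero d
    d≠0 = ℚ.pos⇒nonZero d
    d⁻¹>0 : ℚ.Positive (ℚ.1/ d)
    d⁻¹>0 = ℚ.1/pos⇒pos d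
    η>0 : ℚ.Positive η
    η>0 = ℚ.positive 0<η
  δ = (ℚ.1/ d) ℚ.* η
  instance
    δ>0 : ℚ.Positive δ
    δ>0 = ℚ.pos*pos⇒pos (ℚ.1/ d) η
  dδ≡η : d ℚ.* δ ≡ η
  dδ≡η = trans (sym (ℚ.*-assoc d (ℚ.1/ d) η))
           (trans (cong (ℚ._* η) (ℚ.*-inverseʳ d)) (ℚ.*-identityˡ η))
  open +-*-Solver
  regroup : ∀ p q z e → p ℚ.* z ℚ.+ (q ℚ.- p) ℚ.* (z ℚ.+ e) ≡ q ℚ.* z ℚ.+ (q ℚ.- p) ℚ.* e
  regroup = solve 4 (λ p q z e →
    p :* z :+ (q :- p) :* (z :+ e) := q :* z :+ (q :- p) :* e) refl

-- An inequality unfolds to a statement about the sequences, which does not determine the reals, so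
-- these are passed explicitly.
open Reasoning _≤ᴿ_ (λ {x} → ≤ᴿ-refl {x}) (λ {x} {y} {z} → ≤ᴿ-trans {x} {y} {z})

-- The minimum over all subsets as a greatest lower bound.

minᴿ-lower : ∀ {m} (g : Subset m → ℝ) A → minᴿ g ≤ᴿ g A
minᴿ-lower g [] = ≤ᴿ-refl {g []}
minᴿ-lower g (outside ∷ A) = begin
  minᴿ g                           ∼⟨ x⊓ᴿy≤ᴿx (minᴿ (g ∘ (outside ∷_))) (minᴿ (g ∘ (inside ∷_))) ⟩
  minᴿ (λ B → g (outside ∷ B))     ∼⟨ minᴿ-lower (g ∘ (outside ∷_)) A ⟩
  g (outside ∷ A)                  ∎
minᴿ-lower g (inside ∷ A) = begin
  minᴿ g                           ∼⟨ x⊓ᴿy≤ᴿy (minᴿ (g ∘ (outside ∷_))) (minᴿ (g ∘ (inside ∷_))) ⟩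
  minᴿ (λ B → g (inside ∷ B))      ∼⟨ minᴿ-lower (g ∘ (inside ∷_)) A ⟩
  g (inside ∷ A)                   ∎

minᴿ-glb : ∀ {m} (g : Subset m → ℝ) x → (∀ A → x ≤ᴿ g A) → x ≤ᴿ minᴿ g
minᴿ-glb {ℕ.zero}  g x h = h []
minᴿ-glb {ℕ.suc m} g x h =
  ⊓ᴿ-glb (minᴿ (g ∘ (outside ∷_))) (minᴿ (g ∘ (inside ∷_))) x
    (minᴿ-glb (g ∘ (outside ∷_)) x (h ∘ (outside ∷_)))
    (minᴿ-glb (g ∘ (inside ∷_)) x (h ∘ (inside ∷_)))

-- Integer fractions and sums with few nonzero terms.

-- Reduction to lowest terms does not compute for a variable `k`, so the identity is checked on
-- unnormalised fractions.
suc/1 : ∀ k → (+ ℕ.suc k / 1) ≡ 1ℚ ℚ.+ (+ k / 1)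
suc/1 k = ℚ.toℚᵘ-injective
  -- The second argument of `mkℚᵘ` is the denominator minus one: 0 here stands for 1, and 1 in the
  -- next lemma for 2.
  (ℚᵘ.≃-trans (ℚ.toℚᵘ-fromℚᵘ (ℚᵘ.mkℚᵘ (+ ℕ.suc k) 0))
  (ℚᵘ.≃-trans (ℚᵘ.*≡* (cong (λ z → (+ 1 ℤ.+ z) ℤ.* + 1) (sym (ℤ.*-identityʳ (+ k)))))
  (ℚᵘ.≃-trans (ℚᵘ.+-congʳ ℚᵘ.1ℚᵘ (ℚᵘ.≃-sym (ℚ.toℚᵘ-fromℚᵘ (ℚᵘ.mkℚᵘ (+ k) 0))))
              (ℚᵘ.≃-sym (ℚ.toℚᵘ-homo-+ 1ℚ (+ k / 1))))))

k/1≤n/2 : ∀ k n → k ℕ.* 2 ℕ.≤ n → (+ k / 1) ℚ.≤ (+ n / 2)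
k/1≤n/2 k n 2k≤n = ℚ.toℚᵘ-cancel-≤
  (ℚᵘ.≤-respˡ-≃ (ℚᵘ.≃-sym (ℚ.toℚᵘ-fromℚᵘ (ℚᵘ.mkℚᵘ (+ k) 0)))
  (ℚᵘ.≤-respʳ-≃ (ℚᵘ.≃-sym (ℚ.toℚᵘ-fromℚᵘ (ℚᵘ.mkℚᵘ (+ n) 1)))
    (ℚᵘ.*≤* (ℤ.≤-trans (ℤ.≤-reflexive (sym (ℤ.pos-* k 2)))
      (ℤ.≤-trans (ℤ.+≤+ 2k≤n) (ℤ.≤-reflexive (sym (ℤ.*-identityʳ (+ n)))))))))

-- Serves to bound the cost of an assignment: `g v` will be the value of the block at `v`, and `p`
-- will contain every vertex whose block is nonempty.
sumᴿ≤∣p∣*ᴿ : ∀ {n} (p : Subset n) (g : Fin n → ℝ) x →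
  (∀ v → v ∈ p → g v ≤ᴿ x) → (∀ v → v ∉ p → g v ≤ᴿ 0ᴿ) →
  sumᴿ g ≤ᴿ fromℕ ∣ p ∣ *ᴿ x
sumᴿ≤∣p∣*ᴿ [] g x _ _ =
  pointwise⇒≤ᴿ 0ᴿ (fromℕ 0 *ᴿ x) λ i → ℚ.≤-reflexive (sym (ℚ.*-zeroˡ (seq x i)))
sumᴿ≤∣p∣*ᴿ (outside ∷ p) g x on off = begin
  sumᴿ g                            ∼⟨ +ᴿ-mono-≤ᴿ (g zero) 0ᴿ (sumᴿ (g ∘ suc)) (fromℕ ∣ p ∣ *ᴿ x)
                                         (off zero λ ())
                                         (sumᴿ≤∣p∣*ᴿ p (g ∘ suc) x
                                           (λ v v∈p → on (suc v) (there v∈p))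
                                           (λ v v∉p → off (suc v) (v∉p ∘ drop-there))) ⟩
  0ᴿ +ᴿ fromℕ ∣ p ∣ *ᴿ x            ∼⟨ pointwise⇒≤ᴿ (0ᴿ +ᴿ fromℕ ∣ p ∣ *ᴿ x) (fromℕ ∣ p ∣ *ᴿ x)
                                         (λ _ → ℚ.≤-reflexive (ℚ.+-identityˡ _)) ⟩
  fromℕ ∣ p ∣ *ᴿ x                  ∎
sumᴿ≤∣p∣*ᴿ (inside ∷ p) g x on off = begin
  sumᴿ g                            ∼⟨ +ᴿ-mono-≤ᴿ (g zero) x (sumᴿ (g ∘ suc)) (fromℕ ∣ p ∣ *ᴿ x)
                                         (on zero here)
                                         (sumᴿ≤∣p∣*ᴿ p (g ∘ suc) x
                                           (λ v v∈p → on (suc v) (there v∈p))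
                                           (λ v v∉p → off (suc v) (v∉p ∘ drop-there))) ⟩
  x +ᴿ fromℕ ∣ p ∣ *ᴿ x             ∼⟨ pointwise⇒≤ᴿ (x +ᴿ fromℕ ∣ p ∣ *ᴿ x) (fromℕ (ℕ.suc ∣ p ∣) *ᴿ x)
                                         (λ i → ℚ.≤-reflexive (distrib (seq x i))) ⟩
  fromℕ (ℕ.suc ∣ p ∣) *ᴿ x          ∎
  where
  k/1 = + ∣ p ∣ / 1
  distrib : ∀ z → z ℚ.+ k/1 ℚ.* z ≡ (+ ℕ.suc ∣ p ∣ / 1) ℚ.* z
  distrib z = trans (cong (ℚ._+ k/1 ℚ.* z) (sym (ℚ.*-identityˡ z)))
    (trans (sym (ℚ.*-distribʳ-+ z 1ℚ k/1)) (cong (ℚ._* z) (sym (suc/1 ∣ p ∣))))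

-- Tabulated subsets and cardinalities of disjoint subsets.

∈-tabulate⁺ : ∀ {n} (b : Fin n → Bool) {i} → b i ≡ true → i ∈ tabulate b
∈-tabulate⁺ b {i} e = lookup⇒[]= i (tabulate b) (trans (lookup∘tabulate b i) e)

∈-tabulate⁻ : ∀ {n} (b : Fin n → Bool) {i} → i ∈ tabulate b → b i ≡ true
∈-tabulate⁻ b {i} i∈ = trans (sym (lookup∘tabulate b i)) ([]=⇒lookup i∈)

does⇒ : ∀ {A : Set} (a? : Dec A) → does a? ≡ true → A
does⇒ (yes a) _ = a

disjoint⇒∣p∣+∣q∣≤n : ∀ {n} (p q : Subset n) → (∀ v → v ∈ p → v ∉ q) →
  ∣ p ∣ ℕ.+ ∣ q ∣ ℕ.≤ n
disjoint⇒∣p∣+∣q∣≤n [] [] _ = ℕ.z≤n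
disjoint⇒∣p∣+∣q∣≤n (a ∷ p) (b ∷ q) p#q
  with ih ← disjoint⇒∣p∣+∣q∣≤n p q (λ v v∈p v∈q → p#q (suc v) (there v∈p) (there v∈q))
  with a | b
... | outside | outside = ℕ.m≤n⇒m≤1+n ih
... | outside | inside  = ℕ.≤-trans (ℕ.≤-reflexive (ℕ.+-suc ∣ p ∣ ∣ q ∣)) (ℕ.s≤s ih)
... | inside  | outside = ℕ.s≤s ih
... | inside  | inside  = absurd (p#q zero here here)

m⊓n*2≤m+n : ∀ m n → (m ⊓ n) ℕ.* 2 ℕ.≤ m ℕ.+ n
m⊓n*2≤m+n m n = ℕ.≤-trans
  (ℕ.≤-reflexive (trans (ℕ.*-comm (m ⊓ n) 2) (cong (m ⊓ n ℕ.+_) (ℕ.+-identityʳ (m ⊓ n)))))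
  (ℕ.+-mono-≤ (ℕ.m⊓n≤m m n) (ℕ.m⊓n≤n m n))

-- Subadditivity over finite unions.

-- Folded in the same order as `sumᴿ`, so that one induction on the number of sets handles both.
⋃ᶠ : ∀ {n m} → (Fin n → Subset m) → Subset m
⋃ᶠ = foldr _∪_ ⊥

⊆-⋃ᶠ : ∀ {n m} (B : Fin n → Subset m) v → B v ⊆ ⋃ᶠ B
⊆-⋃ᶠ B zero    = p⊆p∪q (⋃ᶠ (B ∘ suc))
⊆-⋃ᶠ B (suc v) = q⊆p∪q (B zero) (⋃ᶠ (B ∘ suc)) ∘ ⊆-⋃ᶠ (B ∘ suc) v

module _ {m : ℕ} (f : Subset m → ℝ) where

  subadditive : Nonnegative f → Submodular f → ∀ A B → f (A ∪ B) ≤ᴿ f A +ᴿ f B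
  subadditive f≥0 submod A B = begin
    f (A ∪ B)                  ∼⟨ pointwise⇒≤ᴿ (f (A ∪ B)) (f (A ∪ B) +ᴿ 0ᴿ)
                                    (λ _ → ℚ.≤-reflexive (sym (ℚ.+-identityʳ _))) ⟩
    f (A ∪ B) +ᴿ 0ᴿ            ∼⟨ +ᴿ-mono-≤ᴿ (f (A ∪ B)) (f (A ∪ B)) 0ᴿ (f (A ∩ B))
                                    (≤ᴿ-refl {f (A ∪ B)}) (f≥0 (A ∩ B)) ⟩
    f (A ∪ B) +ᴿ f (A ∩ B)     ∼⟨ submod A B ⟩
    f A +ᴿ f B                 ∎

  ⋃ᶠ≤sumᴿ : Nonnegative f → Normalized f → Submodular f →
    ∀ {n} (B : Fin n → Subset m) → f (⋃ᶠ B) ≤ᴿ sumᴿ (f ∘ B)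
  -- The empty union against the empty sum is where normalization enters.
  ⋃ᶠ≤sumᴿ f≥0 f⊥ submod {ℕ.zero}  B = proj₁ f⊥
  ⋃ᶠ≤sumᴿ f≥0 f⊥ submod {ℕ.suc n} B = begin
    f (B zero ∪ ⋃ᶠ (B ∘ suc))            ∼⟨ subadditive f≥0 submod (B zero) (⋃ᶠ (B ∘ suc)) ⟩
    f (B zero) +ᴿ f (⋃ᶠ (B ∘ suc))       ∼⟨ +ᴿ-mono-≤ᴿ (f (B zero)) (f (B zero)) (f (⋃ᶠ (B ∘ suc))) (sumᴿ (f ∘ B ∘ suc))
                                              (≤ᴿ-refl {f (B zero)}) (⋃ᶠ≤sumᴿ f≥0 f⊥ submod (B ∘ suc)) ⟩
    sumᴿ (f ∘ B)                         ∎

module _ {n m : ℕ} (G : Digraph n m) where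
  open Digraph G

  -- Blocks of an assignment and bounds on `f̂pf`.

  ∈-block⁺ : ∀ C H {e} → e ∈ C → e ∈ block G C H (assignedEnd G H e)
  ∈-block⁺ C H {e} e∈C = ∈-tabulate⁺ _
    (cong₂ _∧_ ([]=⇒lookup e∈C) (dec-true (assignedEnd G H e ≟ᶠ assignedEnd G H e) refl))

  ∈-block⁻ : ∀ C H v {e} → e ∈ block G C H v → e ∈ C × assignedEnd G H e ≡ v
  ∈-block⁻ C H v {e} e∈B =
    let eq = ∈-tabulate⁻ (λ e → lookup C e ∧ does (assignedEnd G H e ≟ᶠ v)) e∈B in
    lookup⇒[]= e C (∧-conicalˡ (lookup C e) _ eq) ,
    does⇒ (assignedEnd G H e ≟ᶠ v) (∧-conicalʳ (lookup C e) _ eq)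

  tail∈Δs : ∀ C {e} → e ∈ C → tail e ∈ Δs G C
  tail∈Δs C {e} e∈C = ∈-tabulate⁺ _
    (dec-true (any? λ e′ → e′ ∈? C ×-dec tail e′ ≟ᶠ tail e) (e , e∈C , refl))

  head∈Δt : ∀ C {e} → e ∈ C → head e ∈ Δt G C
  head∈Δt C {e} e∈C = ∈-tabulate⁺ _
    (dec-true (any? λ e′ → e′ ∈? C ×-dec head e′ ≟ᶠ head e) (e , e∈C , refl))

  ∈-Δs⁻ : ∀ C {v} → v ∈ Δs G C → ∃ λ e → e ∈ C × tail e ≡ v
  ∈-Δs⁻ C {v} v∈ = does⇒ (any? λ e → e ∈? C ×-dec tail e ≟ᶠ v) (∈-tabulate⁻ _ v∈)

  ∈-Δt⁻ : ∀ C {v} → v ∈ Δt G C → ∃ λ e → e ∈ C × head e ≡ v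
  ∈-Δt⁻ C {v} v∈ = does⇒ (any? λ e → e ∈? C ×-dec head e ≟ᶠ v) (∈-tabulate⁻ _ v∈)

  module _ (f : Subset m → ℝ) (f⊥ : Normalized f) (mono : Monotone f) where

    -- The blocks of any assignment cover `C`, so monotonicity and subadditivity put `f C` below
    -- every sum over which the minimum is taken.
    f≤f̂pf : Nonnegative f → Submodular f → ∀ C → f C ≤ᴿ f̂pf G f C
    f≤f̂pf f≥0 submod C = minᴿ-glb (λ H → sumᴿ λ v → f (block G C H v)) (f C) λ H → begin
      f C                                ∼⟨ mono C (⋃ᶠ (block G C H))
                                              (λ {e} e∈C → ⊆-⋃ᶠ (block G C H) (assignedEnd G H e) (∈-block⁺ C H e∈C)) ⟩
      f (⋃ᶠ (block G C H))               ∼⟨ ⋃ᶠ≤sumᴿ f f≥0 f⊥ submod (block G C H) ⟩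
      sumᴿ (λ v → f (block G C H v))     ∎

    -- The minimum is at most the sum for the single assignment `H`. Each of its blocks lies in `C`,
    -- and those at vertices outside `p` are empty.
    f̂pf≤∣p∣*ᴿf : ∀ C H p → (∀ {e} → e ∈ C → assignedEnd G H e ∈ p) →
      f̂pf G f C ≤ᴿ fromℕ ∣ p ∣ *ᴿ f C
    f̂pf≤∣p∣*ᴿf C H p ends = begin
      f̂pf G f C                          ∼⟨ minᴿ-lower (λ H → sumᴿ λ v → f (block G C H v)) H ⟩
      sumᴿ (λ v → f (block G C H v))     ∼⟨ sumᴿ≤∣p∣*ᴿ p (f ∘ block G C H) (f C) on off ⟩
      fromℕ ∣ p ∣ *ᴿ f C                 ∎
      where
      on : ∀ v → v ∈ p → f (block G C H v) ≤ᴿ f C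
      on v _ = mono (block G C H v) C (proj₁ ∘ ∈-block⁻ C H v)

      empty : ∀ v → v ∉ p → block G C H v ⊆ ⊥
      empty v v∉p e∈B with ∈-block⁻ C H v e∈B
      ... | e∈C , refl = absurd (v∉p (ends e∈C))

      off : ∀ v → v ∉ p → f (block G C H v) ≤ᴿ 0ᴿ
      off v v∉p = begin
        f (block G C H v)     ∼⟨ mono (block G C H v) ⊥ (empty v v∉p) ⟩
        f ⊥                   ∼⟨ proj₁ f⊥ ⟩
        0ᴿ                    ∎

    f̂pf≤∣Δs∣*ᴿf : ∀ C → f̂pf G f C ≤ᴿ fromℕ ∣ Δs G C ∣ *ᴿ f C
    -- With `H = ⊥` every edge goes to its tail.
    f̂pf≤∣Δs∣*ᴿf C = f̂pf≤∣p∣*ᴿf C ⊥ (Δs G C) ends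
      where
      ends : ∀ {e} → e ∈ C → assignedEnd G ⊥ e ∈ Δs G C
      ends {e} e∈C rewrite lookup-replicate e outside = tail∈Δs C e∈C

    f̂pf≤∣Δt∣*ᴿf : ∀ C → f̂pf G f C ≤ᴿ fromℕ ∣ Δt G C ∣ *ᴿ f C
    -- With `H = ⊤` every edge goes to its head.
    f̂pf≤∣Δt∣*ᴿf C = f̂pf≤∣p∣*ᴿf C ⊤ (Δt G C) ends
      where
      ends : ∀ {e} → e ∈ C → assignedEnd G ⊤ e ∈ Δt G C
      ends {e} e∈C rewrite lookup-replicate e inside = head∈Δt C e∈C

  -- Paths avoiding a minimal cut.

  Avoiding : Subset m → Fin n → Fin n → Set
  Avoiding C = Star (StepAvoiding G C)

  -- In the second case, cut the path before its first and after its last use of e.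
  split-at : ∀ C e {u w} → Avoiding (C - e) u w →
    Avoiding C u w ⊎ (Avoiding C u (tail e) × Avoiding C (head e) w)
  split-at C e ε = inj₁ ε
  split-at C e ((e′ , e′∉C-e , refl , refl) ◅ path) with e′ ≟ᶠ e | split-at C e path
  ... | yes refl | inj₁ rest      = inj₂ (ε , rest)
  ... | yes refl | inj₂ (_ , last)    = inj₂ (ε , last)
  ... | no e′≢e  | inj₁ rest      = inj₁ (step ◅ rest)
    where step = e′ , (λ e′∈C → e′∉C-e (x∈p∧x≢y⇒x∈p-y e′∈C e′≢e)) , refl , refl
  ... | no e′≢e  | inj₂ (first , last) = inj₂ (step ◅ first , last)
    where step = e′ , (λ e′∈C → e′∉C-e (x∈p∧x≢y⇒x∈p-y e′∈C e′≢e)) , refl , refl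

  -- By minimality `C - e` is not a cut, and an s-t path avoiding it must use `e` since `C` is a
  -- cut; its two ends are the required paths. Not being a cut is a doubly negated existence of a
  -- path, hence the double negation here.
  minimal⇒reach : ∀ {s t C e} → IsMinimalCut G s t C → e ∈ C →
    ¬ ¬ (Avoiding C s (tail e) × Avoiding C (head e) t)
  minimal⇒reach {C = C} {e} (cut , minimal) e∈C ¬reach =
    minimal (C - e) (x∈p⇒p-x⊂p e∈C) λ path → [ cut , ¬reach ]′ (split-at C e path)

  Δs#Δt : ∀ {s t C} → IsMinimalCut G s t C → ∀ v → v ∈ Δs G C → v ∉ Δt G C
  Δs#Δt {C = C} min v v∈Δs v∈Δt with ∈-Δs⁻ C v∈Δs | ∈-Δt⁻ C v∈Δt
  ... | e , e∈C , refl | e′ , e′∈C , head≡tail =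
    -- The goal is a contradiction, so the doubly negated paths can be used outright: `e` leaves `v`
    -- and supplies the half from `s`, `e′` enters `v` and supplies the half to `t`.
    minimal⇒reach min e∈C λ (s⇝v , _) →
    minimal⇒reach min e′∈C λ (_ , v⇝t) →
    proj₁ min (s⇝v ◅◅ subst (λ u → Avoiding C u _) head≡tail v⇝t)

theorem3 : ∀ {n m : ℕ} (G : Digraph n m) (s t : Fin n) (f : Subset m → ℝ) →
    Nonnegative f → Normalized f → Monotone f → Submodular f →
    (Ĉ C* : Subset m) → MinimizesPF G s t f Ĉ → MinimalMinimizer G s t f C* →
    (f Ĉ ≤ᴿ fromℕ (∣ Δs G C* ∣ ⊓ ∣ Δt G C* ∣) *ᴿ f C*)
    × (fromℕ (∣ Δs G C* ∣ ⊓ ∣ Δt G C* ∣) *ᴿ f C* ≤ᴿ fromℚ (+ n / 2) *ᴿ f C*)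
theorem3 {n} G s t f f≥0 f⊥ mono submod Ĉ C* (_ , Ĉ-minimizes) (C*-minimal , _) =
  (begin
    f Ĉ                     ∼⟨ f≤f̂pf G f f⊥ mono f≥0 submod Ĉ ⟩
    f̂pf G f Ĉ               ∼⟨ Ĉ-minimizes C* (proj₁ C*-minimal) ⟩
    f̂pf G f C*              ∼⟨ f̂pf≤min ⟩
    fromℕ (a ⊓ b) *ᴿ f C*   ∎) ,
  *ᴿ-monoˡ-≤ (+ (a ⊓ b) / 1) (+ n / 2) (f C*)
    -- Twice the smaller cardinality is at most `a + b`, and disjointness bounds this by `n`.
    (k/1≤n/2 (a ⊓ b) n (ℕ.≤-trans (m⊓n*2≤m+n a b)
      (disjoint⇒∣p∣+∣q∣≤n (Δs G C*) (Δt G C*) (Δs#Δt G C*-minimal))))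
    (f≥0 C*)
  where
  a = ∣ Δs G C* ∣
  b = ∣ Δt G C* ∣
  f̂pf≤min : f̂pf G f C* ≤ᴿ fromℕ (a ⊓ b) *ᴿ f C*
  f̂pf≤min = [ (λ a⊓b≡a → subst bound (sym a⊓b≡a) (f̂pf≤∣Δs∣*ᴿf G f f⊥ mono C*))
            , (λ a⊓b≡b → subst bound (sym a⊓b≡b) (f̂pf≤∣Δt∣*ᴿf G f f⊥ mono C*))
            ]′ (ℕ.⊓-sel a b)
    where
    bound : ℕ → Set
    bound k = f̂pf G f C* ≤ᴿ fromℕ k *ᴿ f C*
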